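{- Let $r\geq1$ and let $G$ be a finite Abelian group of rank $r$ and exponent $n$. Then $$\rho(G) \leq c_r \sum_{d \mid n} \frac{P^-(d)-1}{d}.$$
   Context: $G$ is written additively; writing $G\simeq C_{n_1}\oplus\cdots\oplus C_{n_r}$ with $1<n_1\mid\cdots\mid n_r$, $r$ is the rank and $n_r$ the exponent. A sequence over $G$ is a finite multiset of elements; subsequences are sub-multisets. The cross number is $\mathsf{k}(S)=\sum_{g\in S}1/\mathrm{ord}(g)$ (with multiplicity). A tiny zero-sum subsequence of $S$ is a non-empty subsequence whose elements sum to $0$ and whose cross number is at most $1$. $\rho(G)=\max\{\mathsf{k}(S): S \text{ a sequence over } G \text{ containing no tiny zero-sum subsequence}\}$. $\eta(H)$ is the smallest positive integer $t$ such that every sequence over $H$ of length at least $t$ contains a non-empty zero-sum subsequence of length at most $\exp(H)$. For $r\geq1$, $c_r$ denotes the smallest real constant $c>0$ such that $\eta(C_m^r)\leq c(m-1)+1$ for every integer $m\geq1$ (it exists by a theorem of Alon and Dubiner). $P^-(d)$ is the smallest prime divisor of $d$, with $P^-(1)=1$. -}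

module Defs where

open import Data.Nat as ℕ using (ℕ; zero; suc; _∸_; _<_)
open import Data.Nat.Divisibility using (_∣_; _∣?_)
open import Data.Nat.Primality using (Prime; prime?)
open import Data.Fin using (Fin; toℕ; fromℕ) renaming (_≤_ to _≤ᶠ_)
open import Data.Fin.Properties using (all?)
open import Data.Integer using (+_)
open import Data.Rational using (ℚ; _/_; 0ℚ; 1ℚ) renaming (_+_ to _+ℚ_; _≤_ to _≤ℚ_)
open import Data.List using (List; []; _∷_; map; upTo; length; foldr)
open import Data.List.Relation.Binary.Sublist.Propositional using (_⊆_)
open import Data.Product using (Σ; _×_; ∃)
open import Relation.Nullary using (Dec; yes; no; ¬_)
open import Relation.Nullary.Decidable using (_×-dec_)
open import Relation.Binary.PropositionalEquality using (_≡_)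

firstSat : {P : ℕ → Set} → ((k : ℕ) → Dec (P k)) → ℕ → List ℕ → ℕ
firstSat P? d [] = d
firstSat P? d (k ∷ ks) with P? k
... | yes _ = k
... | no  _ = firstSat P? d ks

-- The group G = C_{n 0} ⊕ ... ⊕ C_{n (r-1)}; an element is a tuple of residues.
Elem : (r : ℕ) → (Fin r → ℕ) → Set
Elem r n = (i : Fin r) → Fin (n i)

card : (r : ℕ) → (Fin r → ℕ) → ℕ
card zero    n = 1
card (suc r) n = n Fin.zero ℕ.* card r (λ i → n (Fin.suc i))
  where import Data.Fin as Fin

Kills : {r : ℕ} {n : Fin r → ℕ} → ℕ → Elem r n → Set
Kills {r} {n} k g = (i : Fin r) → n i ∣ k ℕ.* toℕ (g i)

kills? : {r : ℕ} {n : Fin r → ℕ} → (k : ℕ) → (g : Elem r n) → Dec (Kills k g)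
kills? {n = n} k g = all? (λ i → n i ∣? k ℕ.* toℕ (g i))

-- ord(g): the least positive k with k · g = 0 (searched among 1 .. |G|,
-- which always contains it).  Written as suc of the search result so that it
-- is syntactically nonzero.
ord : {r : ℕ} {n : Fin r → ℕ} → Elem r n → ℕ
ord {r} {n} g = suc (firstSat (λ j → kills? (suc j) g) 0 (upTo (card r n)))

crossNumber : {r : ℕ} {n : Fin r → ℕ} → List (Elem r n) → ℚ
crossNumber S = foldr (λ g acc → (+ 1 / ord g) +ℚ acc) 0ℚ S

ZeroSum : {r : ℕ} {n : Fin r → ℕ} → List (Elem r n) → Set
ZeroSum {r} {n} S = (i : Fin r) → n i ∣ foldr (λ g acc → toℕ (g i) ℕ.+ acc) 0 S

HasTinyZeroSum : {r : ℕ} {n : Fin r → ℕ} → List (Elem r n) → Set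
HasTinyZeroSum {r} {n} S =
  Σ (List (Elem r n)) λ T → T ⊆ S × ¬ (T ≡ []) × ZeroSum T × crossNumber T ≤ℚ 1ℚ

EtaProp : (r m t : ℕ) → Set
EtaProp r m t = (S : List (Elem r (λ _ → m))) → t ℕ.≤ length S →
  Σ (List (Elem r (λ _ → m))) λ T → T ⊆ S × ¬ (T ≡ []) × ZeroSum T × length T ℕ.≤ m

toℚ : ℕ → ℚ
toℚ k = + k / 1

-- c > 0 satisfies η(C_m^r) ≤ c(m-1)+1 for all m ≥ 1.
-- (η(C_m^r) ≤ X  iff  some t with EtaProp r m t has t ≤ X, since EtaProp is
--  upward closed in t and η is its least witness.)
AlonDubinerConst : ℕ → ℚ → Set
AlonDubinerConst r c = Data.Rational._<_ 0ℚ c ×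
  ((m : ℕ) → 1 ℕ.≤ m →
    ∃ λ t → EtaProp r m t × toℚ t ≤ℚ (c Data.Rational.* toℚ (m ∸ 1)) +ℚ 1ℚ)
  where import Data.Rational

-- P⁻(d): smallest prime divisor of d, with P⁻(1) = 1
-- (search over 0..d; default 1 when none, i.e. d = 1).
minPrimeDiv : ℕ → ℕ
minPrimeDiv d = firstSat (λ p → prime? p ×-dec p ∣? d) 1 (upTo (suc d))

divSum : ℕ → ℚ
divSum e = foldr (λ j acc → term j +ℚ acc) 0ℚ (upTo e)
  where
  term : ℕ → ℚ
  term j with suc j ∣? e
  ... | yes _ = + (minPrimeDiv (suc j) ∸ 1) / suc j
  ... | no  _ = 0ℚ

{-# OPTIONS --safe #-}
module Submission where

-- Let p = P⁻(d).  If S has at least η(C_p^r) elements of order d, then some T among them with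
-- |T| ≤ p has a sum σ(T) of order dividing d/p.  Since k(T) ≤ p/d ≤ 1/ord(σ(T)), replacing T
-- by σ(T) does not decrease the cross number, and it creates no tiny zero-sum subsequence;
-- it shortens S, as |T| = 1 is impossible.  When no replacement is possible, S has at most
-- c(P⁻(d) − 1) elements of each order d, and d = 1 does not occur.

open import Defs
open import Data.Nat using (ℕ; suc; _<_)
open import Data.Nat.Divisibility using (_∣_)
open import Data.Fin using (Fin; fromℕ) renaming (_≤_ to _≤ᶠ_)
open import Data.Rational using (ℚ; _*_; _≤_)
open import Data.List using (List)
open import Relation.Nullary using (¬_)

open import Level using (0ℓ)
open import Algebra.Bundles using (CommutativeMonoid)
open import Data.Fin as Fin using (toℕ; fromℕ<)
import Data.Fin.Properties as Finₚ
open import Data.Integer as ℤ using (+_)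
import Data.Integer.Properties as ℤₚ
open import Data.List using ([]; _∷_; map; foldr; length; filter; upTo)
import Data.List.Properties as Listₚ
open import Data.List.Membership.Propositional using (_∈_; lose)
open import Data.List.Membership.Propositional.Properties using (∈-upTo⁺)
open import Data.List.Relation.Binary.Sublist.Propositional
  using (_⊆_; []; _∷_; _∷ʳ_; ⊆-trans; minimum)
open import Data.List.Relation.Binary.Sublist.Propositional.Properties
  using (All-resp-⊆; filter-⊆)
open import Data.List.Relation.Ternary.Interleaving.Propositional
  using (Interleaving; []; consˡ; consʳ)
open import Data.List.Relation.Ternary.Interleaving.Properties using (interleave-length)
open import Data.List.Relation.Unary.All as All using (All; []; _∷_)
open import Data.List.Relation.Unary.All.Properties using (all-filter)
open import Data.List.Relation.Unary.AllPairs using (AllPairs; []; _∷_)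
import Data.List.Relation.Unary.AllPairs.Properties as AllPairsₚ
open import Data.List.Relation.Unary.Any using (Any; here; there)
open import Data.Nat as ℕ using (zero; NonZero; _∸_; _%_; z≤n; s≤s)
import Data.Nat.Properties as ℕₚ
open import Data.Nat.Divisibility
  using (_∣?_; divides; ∣-trans; n∣m*n; m∣m*n; ∣m∣n⇒∣m+n; ∣m+n∣m⇒∣n; ∣n⇒∣m*n;
         m%n≡0⇒n∣m; ∣⇒≤)
open import Data.Nat.DivMod using (m%n<n; m≡m%n+[m/n]*n; m/n*n≡m)
open import Data.Nat.Primality using (Prime; prime?; prime⇒nonTrivial)
open import Data.Nat.Primality.Factorisation using (factorise)
open import Data.Nat.Solver using (module +-*-Solver)
open import Data.Product using (∃; _×_; _,_; proj₁; proj₂)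
open import Data.Rational as ℚ using (_/_; 0ℚ; 1ℚ; _+_)
import Data.Rational.Properties as ℚₚ
import Data.Rational.Unnormalised as ℚᵘ
import Data.Rational.Unnormalised.Properties as ℚᵘₚ
open import Function using (_∘_)
open import Relation.Nullary using (Dec; yes; no; contradiction)
open import Relation.Nullary.Decidable using (_×-dec_)
open import Relation.Binary.PropositionalEquality
  using (_≡_; refl; sym; trans; cong; cong₂; subst; module ≡-Reasoning)

-- Sublists and sums

private variable A B : Set

-- The complement `R` is what stays when `T` is replaced by its sum. Having it as an `Interleaving`
-- lets lengths and sums over `S` split.
⊆-split : {T S : List A} → T ⊆ S → ∃ λ R → Interleaving T R S
⊆-split [] = [] , []
⊆-split (y ∷ʳ τ) = let R , i = ⊆-split τ in y ∷ R , consʳ i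
⊆-split (refl ∷ τ) = let R , i = ⊆-split τ in R , consˡ i

-- Serves to put `T` back in place of its sum: a part `U` of the complement joins with `T` inside
-- `S`.
interleave-⊆ : {T R S U : List A} → Interleaving T R S → U ⊆ R →
  ∃ λ V → V ⊆ S × Interleaving T U V
interleave-⊆ [] [] = [] , [] , []
interleave-⊆ (consˡ i) υ =
  let V , ν , j = interleave-⊆ i υ in _ ∷ V , refl ∷ ν , consˡ j
interleave-⊆ (consʳ i) (y ∷ʳ υ) =
  let V , ν , j = interleave-⊆ i υ in V , y ∷ʳ ν , j
interleave-⊆ (consʳ i) (refl ∷ υ) =
  let V , ν , j = interleave-⊆ i υ in _ ∷ V , refl ∷ ν , consʳ j

interleave-⊆ʳ : {T R S : List A} → Interleaving T R S → R ⊆ S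
interleave-⊆ʳ [] = []
interleave-⊆ʳ (consˡ i) = _ ∷ʳ interleave-⊆ʳ i
interleave-⊆ʳ (consʳ i) = refl ∷ interleave-⊆ʳ i

interleave-≢[] : {T U V : List A} → Interleaving T U V → ¬ (T ≡ []) → ¬ (V ≡ [])
interleave-≢[] [] T≢[] _ = T≢[] refl
interleave-≢[] (consˡ _) _ ()
interleave-≢[] (consʳ _) _ ()

⊆-map⁻ : (f : A → B) (L : List A) {T : List B} → T ⊆ map f L →
  ∃ λ U → U ⊆ L × T ≡ map f U
⊆-map⁻ f [] [] = [] , [] , refl
⊆-map⁻ f (x ∷ L) (_ ∷ʳ τ) = let U , υ , eq = ⊆-map⁻ f L τ in U , x ∷ʳ υ , eq
⊆-map⁻ f (x ∷ L) (refl ∷ τ) =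
  let U , υ , eq = ⊆-map⁻ f L τ in x ∷ U , refl ∷ υ , cong (f x ∷_) eq

module _ (M : CommutativeMonoid 0ℓ 0ℓ) where
  open CommutativeMonoid M renaming (refl to ≈-refl; sym to ≈-sym; trans to ≈-trans)

  -- Stated over a commutative monoid because it is applied both to coordinate sums in ℕ and to
  -- cross numbers in ℚ.
  ∑-interleave : (f : A → Carrier) {T R S : List A} → Interleaving T R S →
    foldr (λ x acc → f x ∙ acc) ε S ≈
      foldr (λ x acc → f x ∙ acc) ε T ∙ foldr (λ x acc → f x ∙ acc) ε R
  ∑-interleave f [] = ≈-sym (identityˡ ε)
  ∑-interleave f (consˡ i) = ≈-trans (∙-congˡ (∑-interleave f i)) (≈-sym (assoc _ _ _))
  ∑-interleave f (consʳ i) =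
    ≈-trans (∙-congˡ (∑-interleave f i))
    (≈-trans (≈-sym (assoc _ _ _)) (≈-trans (∙-congʳ (comm _ _)) (assoc _ _ _)))

∑ : (A → ℚ) → List A → ℚ
∑ f = foldr (λ x acc → f x + acc) 0ℚ

∑-mono : {f g : A → ℚ} → (∀ x → f x ≤ g x) → ∀ xs → ∑ f xs ≤ ∑ g xs
∑-mono f≤g [] = ℚₚ.≤-refl
∑-mono f≤g (x ∷ xs) = ℚₚ.+-mono-≤ (f≤g x) (∑-mono f≤g xs)

∑-*ˡ : (c : ℚ) (f : A → ℚ) → ∀ xs → ∑ (λ x → c * f x) xs ≡ c * ∑ f xs
∑-*ˡ c f [] = sym (ℚₚ.*-zeroʳ c)
∑-*ˡ c f (x ∷ xs) =
  trans (cong (λ z → c * f x + z) (∑-*ˡ c f xs)) (sym (ℚₚ.*-distribˡ-+ c (f x) (∑ f xs)))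

∑-0 : (xs : List A) → ∑ (λ _ → 0ℚ) xs ≡ 0ℚ
∑-0 [] = refl
∑-0 (x ∷ xs) = trans (ℚₚ.+-identityˡ (∑ (λ _ → 0ℚ) xs)) (∑-0 xs)

-- Accounts for one new element of a sequence sorted by order: the class at index `a` gains `ε`, and
-- no other class shrinks.
∑-bump : {f g : A → ℚ} {a : A} {ε : ℚ} → (∀ x → f x ≤ g x) → ε + f a ≤ g a →
  ∀ {xs} → a ∈ xs → ε + ∑ f xs ≤ ∑ g xs
∑-bump {f = f} {ε = ε} f≤g bump {x ∷ xs} (here refl) =
  ℚₚ.≤-trans (ℚₚ.≤-reflexive (sym (ℚₚ.+-assoc ε (f x) (∑ f xs))))
    (ℚₚ.+-mono-≤ bump (∑-mono f≤g xs))
∑-bump {f = f} {g} {ε = ε} f≤g bump {x ∷ xs} (there a∈xs) =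
  ℚₚ.≤-trans (ℚₚ.≤-reflexive swap) (ℚₚ.+-mono-≤ (f≤g x) (∑-bump {ε = ε} f≤g bump a∈xs))
  where
  swap : ε + (f x + ∑ f xs) ≡ f x + (ε + ∑ f xs)
  swap = trans (sym (ℚₚ.+-assoc ε (f x) (∑ f xs)))
    (trans (cong (_+ ∑ f xs) (ℚₚ.+-comm ε (f x))) (ℚₚ.+-assoc (f x) ε (∑ f xs)))

-- Fractions

-- `_/_` reduces to lowest terms, so the comparison passes to unnormalised fractions, where it is
-- cross-multiplication.
/-mono : ∀ a b c d → a ℕ.* suc d ℕ.≤ c ℕ.* suc b → + a / suc b ≤ + c / suc d
/-mono a b c d le = ℚₚ.toℚᵘ-cancel-≤ (begin
  ℚ.toℚᵘ (+ a / suc b)   ≃⟨ ℚₚ.toℚᵘ-fromℚᵘ (ℚᵘ.mkℚᵘ (+ a) b) ⟩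
  ℚᵘ.mkℚᵘ (+ a) b        ≤⟨ ℚᵘ.*≤* cross ⟩
  ℚᵘ.mkℚᵘ (+ c) d        ≃⟨ ℚₚ.toℚᵘ-fromℚᵘ (ℚᵘ.mkℚᵘ (+ c) d) ⟨
  ℚ.toℚᵘ (+ c / suc d)   ∎)
  where
  open ℚᵘₚ.≤-Reasoning
  cross : + a ℤ.* + suc d ℤ.≤ + c ℤ.* + suc b
  cross rewrite sym (ℤₚ.pos-* a (suc d)) | sym (ℤₚ.pos-* c (suc b)) = ℤ.+≤+ le

toℚ-*-recip : ∀ a b → toℚ a * (+ 1 / suc b) ≡ + a / suc b
toℚ-*-recip a b = ℚₚ.toℚᵘ-injective (begin
  ℚ.toℚᵘ (toℚ a * (+ 1 / suc b))
    ≈⟨ ℚₚ.toℚᵘ-homo-* (toℚ a) (+ 1 / suc b) ⟩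
  ℚ.toℚᵘ (toℚ a) ℚᵘ.* ℚ.toℚᵘ (+ 1 / suc b)
    ≈⟨ ℚᵘₚ.*-cong (ℚₚ.toℚᵘ-fromℚᵘ (ℚᵘ.mkℚᵘ (+ a) 0)) (ℚₚ.toℚᵘ-fromℚᵘ (ℚᵘ.mkℚᵘ (+ 1) b)) ⟩
  ℚᵘ.mkℚᵘ (+ a) 0 ℚᵘ.* ℚᵘ.mkℚᵘ (+ 1) b
    ≈⟨ ℚᵘ.*≡* (cong₂ ℤ._*_ (ℤₚ.*-identityʳ (+ a)) (cong +_ (sym (ℕₚ.+-identityʳ (suc b))))) ⟩
  ℚᵘ.mkℚᵘ (+ a) b
    ≈⟨ ℚₚ.toℚᵘ-fromℚᵘ (ℚᵘ.mkℚᵘ (+ a) b) ⟨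
  ℚ.toℚᵘ (+ a / suc b) ∎)
  where open import Relation.Binary.Reasoning.Setoid ℚᵘₚ.≃-setoid

toℚ-suc : ∀ a → toℚ (suc a) ≡ 1ℚ + toℚ a
toℚ-suc a = ℚₚ.toℚᵘ-injective (begin
  ℚ.toℚᵘ (toℚ (suc a))      ≈⟨ ℚₚ.toℚᵘ-fromℚᵘ (ℚᵘ.mkℚᵘ (+ suc a) 0) ⟩
  ℚᵘ.mkℚᵘ (+ suc a) 0       ≈⟨ ℚᵘ.*≡* (cong (λ z → (+ 1 ℤ.+ z) ℤ.* + 1)
                                 (sym (ℤₚ.*-identityʳ (+ a)))) ⟩
  ℚᵘ.1ℚᵘ ℚᵘ.+ ℚᵘ.mkℚᵘ (+ a) 0
    ≈⟨ ℚᵘₚ.+-congʳ ℚᵘ.1ℚᵘ (ℚₚ.toℚᵘ-fromℚᵘ (ℚᵘ.mkℚᵘ (+ a) 0)) ⟨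
  ℚᵘ.1ℚᵘ ℚᵘ.+ ℚ.toℚᵘ (toℚ a) ≈⟨ ℚₚ.toℚᵘ-homo-+ 1ℚ (toℚ a) ⟨
  ℚ.toℚᵘ (1ℚ + toℚ a)       ∎)
  where open import Relation.Binary.Reasoning.Setoid ℚᵘₚ.≃-setoid

+-cancelˡ-≤ : ∀ r {p q} → r + p ≤ r + q → p ≤ q
+-cancelˡ-≤ r r+p≤r+q = ℚₚ.≮⇒≥ λ q<p → ℚₚ.<-irrefl refl (ℚₚ.<-≤-trans (ℚₚ.+-monoʳ-< r q<p) r+p≤r+q)

recip-cong : ∀ {a b} .{{_ : NonZero a}} .{{_ : NonZero b}} → a ≡ b → + 1 / a ≡ + 1 / b
recip-cong refl = refl

toℚ-mono : ∀ {a b} → a ℕ.≤ b → toℚ a ≤ toℚ b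
toℚ-mono {a} {b} a≤b = /-mono a 0 b 0 (ℕₚ.*-monoˡ-≤ 1 a≤b)

-- Divisibility and minimal search

firstSat-sat : {P : ℕ → Set} (P? : ∀ k → Dec (P k)) (d : ℕ) {ks : List ℕ} →
  Any P ks → P (firstSat P? d ks)
firstSat-sat P? d {k ∷ ks} any with P? k
firstSat-sat P? d {k ∷ ks} any | yes Pk = Pk
firstSat-sat P? d {k ∷ ks} (here Pk) | no ¬Pk = contradiction Pk ¬Pk
firstSat-sat P? d {k ∷ ks} (there any) | no ¬Pk = firstSat-sat P? d any

-- In an increasing list, everything after the first hit exceeds it.
firstSat-least : {P : ℕ → Set} (P? : ∀ k → Dec (P k)) (d : ℕ) {ks : List ℕ} →
  AllPairs _<_ ks → ∀ {k} → k ∈ ks → P k → firstSat P? d ks ℕ.≤ k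
firstSat-least P? d {j ∷ ks} (j<ks ∷ _) k∈ Pk with P? j
firstSat-least P? d {j ∷ ks} (j<ks ∷ _) (here refl) Pk | yes _ = ℕₚ.≤-refl
firstSat-least P? d {j ∷ ks} (j<ks ∷ _) (there k∈) Pk | yes _ = ℕₚ.<⇒≤ (All.lookup j<ks k∈)
firstSat-least P? d {j ∷ ks} (_ ∷ _) (here refl) Pk | no ¬Pj = contradiction Pk ¬Pj
firstSat-least P? d {j ∷ ks} (_ ∷ ks↗) (there k∈) Pk | no _ = firstSat-least P? d ks↗ k∈ Pk

upTo-increasing : ∀ n → AllPairs _<_ (upTo n)
upTo-increasing n = AllPairsₚ.applyUpTo⁺₁ (λ x → x) n (λ i<j _ → i<j)

∃-prime-divisor : ∀ d → 1 < d → ∃ λ p → Prime p × p ∣ d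
∃-prime-divisor d@(suc _) 1<d with factorise d
... | record { factors = [] ; isFactorisation = d≡1 } =
  contradiction (sym d≡1) (ℕₚ.<⇒≢ 1<d)
... | record { factors = p ∷ ps ; isFactorisation = eq ; factorsPrime = p-prime ∷ _ } =
  p , p-prime , subst (p ∣_) (sym eq) (m∣m*n _)

-- A prime divisor of `d` lies in the searched range from 0 to `d`, so the search succeeds and the
-- default 1 is not returned.
minPrimeDiv-spec : ∀ d → 1 < d → Prime (minPrimeDiv d) × minPrimeDiv d ∣ d
minPrimeDiv-spec d@(suc _) 1<d =
  let p , p-prime , p∣d = ∃-prime-divisor d 1<d in
  firstSat-sat (λ p → prime? p ×-dec p ∣? d) 1
    (lose (∈-upTo⁺ (s≤s (∣⇒≤ p∣d))) (p-prime , p∣d))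

∣-%-+ : ∀ n s u .{{_ : NonZero n}} → n ∣ s % n ℕ.+ u → n ∣ s ℕ.+ u
∣-%-+ n s u n∣ = subst (n ∣_) (sym eq) (∣m∣n⇒∣m+n n∣ (n∣m*n (s ℕ./ n)))
  where
  eq : s ℕ.+ u ≡ s % n ℕ.+ u ℕ.+ s ℕ./ n ℕ.* n
  eq = trans (cong (ℕ._+ u) (m≡m%n+[m/n]*n s n))
    (+-*-Solver.solve 3 (λ a b c → (a :+ b) :+ c := (a :+ c) :+ b) refl (s % n) (s ℕ./ n ℕ.* n) u)
    where open +-*-Solver

∣-*-% : ∀ n q s .{{_ : NonZero n}} → n ∣ q ℕ.* s → n ∣ q ℕ.* (s % n)
∣-*-% n q s n∣ =
  ∣m+n∣m⇒∣n (subst (n ∣_) eq n∣) (∣n⇒∣m*n q (n∣m*n (s ℕ./ n)))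
  where
  eq : q ℕ.* s ≡ q ℕ.* (s ℕ./ n ℕ.* n) ℕ.+ q ℕ.* (s % n)
  eq = trans (cong (q ℕ.*_) (trans (m≡m%n+[m/n]*n s n) (ℕₚ.+-comm (s % n) _)))
         (ℕₚ.*-distribˡ-+ q _ _)

∣-card : ∀ r (n : Fin r → ℕ) i → n i ∣ card r n
∣-card (suc r) n Fin.zero = m∣m*n _
∣-card (suc r) n (Fin.suc i) = ∣n⇒∣m*n (n Fin.zero) (∣-card r (n ∘ Fin.suc) i)

card-nonZero : ∀ r (n : Fin r → ℕ) → (∀ i → NonZero (n i)) → NonZero (card r n)
card-nonZero zero n pos = _
card-nonZero (suc r) n pos =
  ℕₚ.m*n≢0 _ _ {{pos Fin.zero}} {{card-nonZero r (n ∘ Fin.suc) (pos ∘ Fin.suc)}}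

-- Orders and compression

module _ {r : ℕ} {n : Fin r → ℕ} {{pos : ∀ {i} → NonZero (n i)}} where

  private
    G : Set
    G = Elem r n

  card-kills : (g : G) → Kills (card r n) g
  card-kills g i = ∣-trans (∣-card r n i) (m∣m*n _)

  private
    -- The search in `ord` tests `suc j` for `j` below |G|. Its last index `c` stands for |G|
    -- itself, which kills every element, so the search cannot fail.
    card-pred : ∃ λ c → card r n ≡ suc c
    card-pred with card r n | card-nonZero r n (λ i → pos {i})
    ... | suc c | _ = c , refl

    c = proj₁ card-pred

    c∈upTo : c ∈ upTo (card r n)
    c∈upTo = ∈-upTo⁺ (subst (c <_) (sym (proj₂ card-pred)) ℕₚ.≤-refl)

    suc-c-kills : (g : G) → Kills (suc c) g
    suc-c-kills g = subst (λ k → Kills k g) (proj₂ card-pred) (card-kills g)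

  ord-kills : (g : G) → Kills (ord g) g
  ord-kills g = firstSat-sat (λ j → kills? (suc j) g) 0 (lose c∈upTo (suc-c-kills g))

  ord-least : (g : G) (k : ℕ) .{{_ : NonZero k}} → Kills k g → ord g ℕ.≤ k
  ord-least g (suc k) kills with k ℕ.<? card r n
  ... | yes k<card =
    s≤s (firstSat-least (λ j → kills? (suc j) g) 0 (upTo-increasing _) (∈-upTo⁺ k<card) kills)
  -- Here |G| ≤ `k`, and the order is at most `suc c` = |G|.
  ... | no k≮card = s≤s (ℕₚ.≤-trans
    (firstSat-least (λ j → kills? (suc j) g) 0 (upTo-increasing _) c∈upTo (suc-c-kills g))
    (ℕₚ.≤-trans (ℕₚ.n≤1+n c) (subst (ℕ._≤ k) (proj₂ card-pred) (ℕₚ.≮⇒≥ k≮card))))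

  -- Division with remainder: a non-zero remainder would kill `g` and be smaller than its order.
  ord-∣ : (g : G) (k : ℕ) → Kills k g → ord g ∣ k
  ord-∣ g k kills with k % ord g in eq
  ... | zero = m%n≡0⇒n∣m k (ord g) eq
  ... | suc m = contradiction (ord-least g (suc m) rem-kills)
                  (ℕₚ.<⇒≱ (subst (_< ord g) eq (m%n<n k (ord g))))
    where
    rem-kills : Kills (suc m) g
    rem-kills i = ∣m+n∣m⇒∣n (subst (n i ∣_) split (kills i))
      (∣n⇒∣m*n (k ℕ./ ord g) (ord-kills g i))
      where
      x = toℕ (g i)
      split : k ℕ.* x ≡ k ℕ./ ord g ℕ.* (ord g ℕ.* x) ℕ.+ suc m ℕ.* x
      split = begin
        k ℕ.* x                                           ≡⟨ cong (ℕ._* x) (m≡m%n+[m/n]*n k (ord g)) ⟩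
        (k % ord g ℕ.+ k ℕ./ ord g ℕ.* ord g) ℕ.* x       ≡⟨ cong (λ z → (z ℕ.+ k ℕ./ ord g ℕ.* ord g) ℕ.* x) eq ⟩
        (suc m ℕ.+ k ℕ./ ord g ℕ.* ord g) ℕ.* x           ≡⟨ solve 4 (λ a b c x → (a :+ b :* c) :* x
                                                               := b :* (c :* x) :+ a :* x) refl
                                                               (suc m) (k ℕ./ ord g) (ord g) x ⟩
        k ℕ./ ord g ℕ.* (ord g ℕ.* x) ℕ.+ suc m ℕ.* x     ∎
        where
        open ≡-Reasoning
        open +-*-Solver

  -- Sums of sequences and the residue map to C_p^r

  coordSum : Fin r → List G → ℕ
  coordSum i = foldr (λ g acc → toℕ (g i) ℕ.+ acc) 0

  σ : List G → G
  σ T i = fromℕ< (m%n<n (coordSum i T) (n i))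

  toℕ-σ : ∀ T i → toℕ (σ T i) ≡ coordSum i T % n i
  toℕ-σ T i = Finₚ.toℕ-fromℕ< _

  crossNumber-const : ∀ j (T : List G) → All (λ g → ord g ≡ suc j) T →
    crossNumber T ≡ + length T / suc j
  crossNumber-const j T ords = trans (go T ords) (toℚ-*-recip (length T) j)
    where
    go : ∀ T → All (λ g → ord g ≡ suc j) T → crossNumber T ≡ toℚ (length T) * (+ 1 / suc j)
    go [] [] = sym (ℚₚ.*-zeroˡ (+ 1 / suc j))
    go (g ∷ T) (o ∷ os) = begin
      (+ 1 / ord g) + crossNumber T
        ≡⟨ cong₂ _+_ (recip-cong o) (go T os) ⟩
      (+ 1 / suc j) + toℚ (length T) * (+ 1 / suc j)
        ≡⟨ cong (_+ toℚ (length T) * (+ 1 / suc j)) (ℚₚ.*-identityˡ (+ 1 / suc j)) ⟨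
      1ℚ * (+ 1 / suc j) + toℚ (length T) * (+ 1 / suc j)
        ≡⟨ ℚₚ.*-distribʳ-+ (+ 1 / suc j) 1ℚ (toℚ (length T)) ⟨
      (1ℚ + toℚ (length T)) * (+ 1 / suc j)
        ≡⟨ cong (_* (+ 1 / suc j)) (toℚ-suc (length T)) ⟨
      toℚ (suc (length T)) * (+ 1 / suc j) ∎
      where open ≡-Reasoning

  -- An element killed by d has all d·gᵢ/nᵢ integral.  Reducing these modulo p ∣ d gives
  -- a homomorphism from G[d] to C_p^r whose kernel is killed by d/p.
  residue : (d p : ℕ) .{{_ : NonZero p}} → G → Elem r (λ _ → p)
  residue d p g i = fromℕ< (m%n<n (d ℕ.* toℕ (g i) ℕ./ n i) p)

  -- Each d·gᵢ is an exact multiple of nᵢ. The quotient differs from its residue by a multiple of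
  -- `p`, and `k` collects these multiples over `T`.
  residue-sum : ∀ d p .{{_ : NonZero p}} (T : List G) → All (Kills d) T → ∀ i →
    ∃ λ k → d ℕ.* coordSum i T ≡
      (foldr (λ g acc → toℕ (g i) ℕ.+ acc) 0 (map (residue d p) T) ℕ.+ k ℕ.* p) ℕ.* n i
  residue-sum d p [] [] i = 0 , ℕₚ.*-zeroʳ d
  residue-sum d p (g ∷ T) (kills ∷ ks) i =
    let k , eq = residue-sum d p T ks i in
    y ℕ./ p ℕ.+ k , (begin
      d ℕ.* (toℕ (g i) ℕ.+ coordSum i T)
        ≡⟨ ℕₚ.*-distribˡ-+ d (toℕ (g i)) (coordSum i T) ⟩
      d ℕ.* toℕ (g i) ℕ.+ d ℕ.* coordSum i T
        ≡⟨ cong₂ ℕ._+_ (sym (m/n*n≡m (kills i))) eq ⟩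
      y ℕ.* n i ℕ.+ (Y ℕ.+ k ℕ.* p) ℕ.* n i
        ≡⟨ cong (λ z → z ℕ.* n i ℕ.+ (Y ℕ.+ k ℕ.* p) ℕ.* n i) (m≡m%n+[m/n]*n y p) ⟩
      (y % p ℕ.+ y ℕ./ p ℕ.* p) ℕ.* n i ℕ.+ (Y ℕ.+ k ℕ.* p) ℕ.* n i
        ≡⟨ solve 6 (λ a b Y k p m → (a :+ b :* p) :* m :+ (Y :+ k :* p) :* m
                      := (a :+ Y :+ (b :+ k) :* p) :* m) refl
             (y % p) (y ℕ./ p) Y k p (n i) ⟩
      (y % p ℕ.+ Y ℕ.+ (y ℕ./ p ℕ.+ k) ℕ.* p) ℕ.* n i
        ≡⟨ cong (λ z → (z ℕ.+ Y ℕ.+ (y ℕ./ p ℕ.+ k) ℕ.* p) ℕ.* n i)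
             (Finₚ.toℕ-fromℕ< (m%n<n y p)) ⟨
      (toℕ (residue d p g i) ℕ.+ Y ℕ.+ (y ℕ./ p ℕ.+ k) ℕ.* p) ℕ.* n i ∎)
    where
    open ≡-Reasoning
    open +-*-Solver
    y = d ℕ.* toℕ (g i) ℕ./ n i
    Y = foldr (λ g acc → toℕ (g i) ℕ.+ acc) 0 (map (residue d p) T)

  -- If the residues sum to a multiple of `p`, then q·p times the coordinate sum is a multiple of
  -- p·nᵢ, and `p` cancels.
  residue-kernel : ∀ q p .{{_ : NonZero p}} (T : List G) → All (Kills (q ℕ.* p)) T →
    ZeroSum (map (residue (q ℕ.* p) p) T) → ∀ i → n i ∣ q ℕ.* coordSum i T
  residue-kernel q p T kills zs i =
    let k , eq = residue-sum (q ℕ.* p) p T kills i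
        divides l eq′ = ∣m∣n⇒∣m+n (zs i) (n∣m*n k)
    in divides l (ℕₚ.*-cancelʳ-≡ _ _ p (trans (rearr q (coordSum i T) p)
         (trans eq (trans (cong (ℕ._* n i) eq′) (sym (rearr l (n i) p))))))
    where
    rearr : ∀ a b c → a ℕ.* b ℕ.* c ≡ a ℕ.* c ℕ.* b
    rearr = solve 3 (λ a b c → a :* b :* c := a :* c :* b) refl
      where open +-*-Solver

  -- Replacing a subsequence by its sum

  hasTiny-replace : {T R S : List G} → Interleaving T R S → ¬ (T ≡ []) →
    crossNumber T ≤ + 1 / ord (σ T) → HasTinyZeroSum (σ T ∷ R) → HasTinyZeroSum S
  -- A tiny zero-sum subsequence that avoids `σ T` already lies in `S`.
  hasTiny-replace i _ _ (U , _ ∷ʳ υ , tiny) = U , ⊆-trans υ (interleave-⊆ʳ i) , tiny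
  -- Otherwise `T` is put back for `σ T`: the sum is unchanged modulo each `n l`, and by `k≤` the
  -- cross number does not grow.
  hasTiny-replace {T} i T≢[] k≤ (_ ∷ U , refl ∷ υ , _ , zs , tiny) =
    let V , ν , j = interleave-⊆ i υ in
    V , ν , interleave-≢[] j T≢[] ,
    (λ l → subst (n l ∣_) (sym (∑-interleave ℕₚ.+-0-commutativeMonoid (λ g → toℕ (g l)) j))
      (∣-%-+ (n l) (coordSum l T) (coordSum l U)
        (subst (λ z → n l ∣ z ℕ.+ coordSum l U) (toℕ-σ T l) (zs l)))) ,
    ℚₚ.≤-trans
      (ℚₚ.≤-reflexive (∑-interleave ℚₚ.+-0-commutativeMonoid (λ g → + 1 / ord g) j))
      (ℚₚ.≤-trans (ℚₚ.+-monoˡ-≤ (crossNumber U) k≤) tiny)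

  ofOrder : ℕ → List G → List G
  ofOrder d = filter (λ g → ord g ℕ.≟ d)

  σ-kills : ∀ q (T : List G) → (∀ i → n i ∣ q ℕ.* coordSum i T) → Kills q (σ T)
  σ-kills q T n∣ i =
    subst (λ z → n i ∣ q ℕ.* z) (sym (toℕ-σ T i)) (∣-*-% (n i) q (coordSum i T) (n∣ i))

  module _ {p j : ℕ} (q : ℕ) (1<p : 1 < p) (d≡qp : suc j ≡ q ℕ.* p)
           {T : List G} (T≢[] : ¬ (T ≡ [])) (ords : All (λ g → ord g ≡ suc j) T)
           (q-kills : ∀ i → n i ∣ q ℕ.* coordSum i T) where
    private instance
      q-nonZero : NonZero q
      q-nonZero = ℕ.≢-nonZero λ { refl → ℕₚ.1+n≢0 d≡qp }

    -- `q` kills the sum of `T`, but it cannot kill a single element of order q·p > q. This makes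
    -- the replacement strictly shorter.
    2≤length : 2 ℕ.≤ length T
    2≤length = go T T≢[] ords q-kills
      where
      go : ∀ T → ¬ (T ≡ []) → All (λ g → ord g ≡ suc j) T →
        (∀ i → n i ∣ q ℕ.* coordSum i T) → 2 ℕ.≤ length T
      go [] T≢[] _ _ = contradiction refl T≢[]
      go (_ ∷ _ ∷ _) _ _ _ = s≤s (s≤s z≤n)
      go (g ∷ []) _ (o ∷ []) q-kills = contradiction
        (subst (ℕ._≤ q) (trans o d≡qp) (ord-least g q
          (λ i → subst (λ z → n i ∣ q ℕ.* z) (ℕₚ.+-identityʳ (toℕ (g i))) (q-kills i))))
        (ℕₚ.<⇒≱ (ℕₚ.m<m*n q p 1<p))

    -- With d = q·p, k(T) = |T|/d ≤ p/d = 1/q, and the order of the sum is at most `q` because `q`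
    -- kills it.
    crossNumber≤1/ord-σ : length T ℕ.≤ p → crossNumber T ≤ + 1 / ord (σ T)
    crossNumber≤1/ord-σ |T|≤p = ℚₚ.≤-trans
      (ℚₚ.≤-reflexive (crossNumber-const j T ords))
      (/-mono (length T) j 1 (ℕ.pred (ord (σ T))) (begin
        length T ℕ.* ord (σ T)  ≤⟨ ℕₚ.*-mono-≤ |T|≤p (ord-least (σ T) q (σ-kills q T q-kills)) ⟩
        p ℕ.* q                 ≡⟨ ℕₚ.*-comm p q ⟩
        q ℕ.* p                 ≡⟨ d≡qp ⟨
        suc j                   ≡⟨ ℕₚ.+-identityʳ (suc j) ⟨
        1 ℕ.* suc j             ∎))
      where open ℕₚ.≤-Reasoning

  replace-σ : ∀ {T R S} → Interleaving T R S → ¬ (T ≡ []) → 2 ℕ.≤ length T →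
    crossNumber T ≤ + 1 / ord (σ T) → ¬ HasTinyZeroSum S →
    ∃ λ S′ → length S′ < length S × crossNumber S ≤ crossNumber S′ × ¬ HasTinyZeroSum S′
  replace-σ {T} {R} i T≢[] 2≤|T| k≤ ¬tiny =
    σ T ∷ R ,
    subst (suc (length R) <_) (sym (interleave-length i)) (ℕₚ.+-monoˡ-≤ (length R) 2≤|T|) ,
    ℚₚ.≤-trans
      (ℚₚ.≤-reflexive (∑-interleave ℚₚ.+-0-commutativeMonoid (λ g → + 1 / ord g) i))
      (ℚₚ.+-monoˡ-≤ (crossNumber R) k≤) ,
    ¬tiny ∘ hasTiny-replace i T≢[] k≤

  -- The images of `L` in C_p^r form a sequence of the same length, to which `η` applies. The short
  -- zero-sum part found there is lifted to `L`, where `residue-kernel` controls its sum.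
  short-q-zeroSum : ∀ {p t} q .{{_ : NonZero p}} → EtaProp r p t →
    (L : List G) → All (Kills (q ℕ.* p)) L → t ℕ.≤ length L →
    ∃ λ T → T ⊆ L × ¬ (T ≡ []) × length T ℕ.≤ p × (∀ i → n i ∣ q ℕ.* coordSum i T)
  short-q-zeroSum {p} {t} q η L kills t≤ =
    let T′ , τ′ , T′≢[] , zs , |T′|≤p = η (map ρ L)
          (subst (t ℕ.≤_) (sym (Listₚ.length-map ρ L)) t≤)
    in pull T′≢[] zs |T′|≤p (⊆-map⁻ ρ L τ′)
    where
    ρ : G → Elem r (λ _ → p)
    ρ = residue (q ℕ.* p) p

    pull : ∀ {T′} → ¬ (T′ ≡ []) → ZeroSum T′ → length T′ ℕ.≤ p →
      (∃ λ T → T ⊆ L × T′ ≡ map ρ T) →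
      ∃ λ T → T ⊆ L × ¬ (T ≡ []) × length T ℕ.≤ p × (∀ i → n i ∣ q ℕ.* coordSum i T)
    pull T′≢[] zs |T′|≤p (T , τ , refl) =
      T , τ , (λ { refl → T′≢[] refl }) ,
      subst (ℕ._≤ p) (Listₚ.length-map ρ T) |T′|≤p ,
      residue-kernel q p T (All-resp-⊆ τ kills) zs

  compress : ∀ {p t} j → 1 < p → p ∣ suc j → EtaProp r p t → (S : List G) →
    t ℕ.≤ length (ofOrder (suc j) S) → ¬ HasTinyZeroSum S →
    ∃ λ S′ → length S′ < length S × crossNumber S ≤ crossNumber S′ × ¬ HasTinyZeroSum S′
  compress {p} j 1<p (divides q d≡qp) η S t≤ ¬tiny =
    step (short-q-zeroSum q {{ℕ.>-nonZero (ℕₚ.<-trans (s≤s z≤n) 1<p)}} η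
      (ofOrder (suc j) S) (All.map (λ {g} → kills-qp g) ords) t≤)
    where
    ords : All (λ g → ord g ≡ suc j) (ofOrder (suc j) S)
    ords = all-filter (λ g → ord g ℕ.≟ suc j) S

    kills-qp : ∀ g → ord g ≡ suc j → Kills (q ℕ.* p) g
    kills-qp g o = subst (λ k → Kills k g) (trans o d≡qp) (ord-kills g)

    step : (∃ λ T → T ⊆ ofOrder (suc j) S × ¬ (T ≡ []) × length T ℕ.≤ p ×
             (∀ i → n i ∣ q ℕ.* coordSum i T)) →
      ∃ λ S′ → length S′ < length S × crossNumber S ≤ crossNumber S′ × ¬ HasTinyZeroSum S′
    step (T , τ , T≢[] , |T|≤p , q-kills) =
      replace-σ (proj₂ (⊆-split (⊆-trans τ (filter-⊆ (λ g → ord g ℕ.≟ suc j) S)))) T≢[]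
        (2≤length q 1<p d≡qp T≢[] (All-resp-⊆ τ ords) q-kills)
        (crossNumber≤1/ord-σ q 1<p d≡qp T≢[] (All-resp-⊆ τ ords) q-kills |T|≤p) ¬tiny

  -- Sorting by order and incompressible sequences

  ofOrder-1≡[] : (S : List G) → ¬ HasTinyZeroSum S → ofOrder 1 S ≡ []
  ofOrder-1≡[] S ¬tiny = go (ofOrder 1 S) (filter-⊆ (λ g → ord g ℕ.≟ 1) S)
    (all-filter (λ g → ord g ℕ.≟ 1) S)
    where
    go : ∀ L → L ⊆ S → All (λ g → ord g ≡ 1) L → L ≡ []
    go [] _ _ = refl
    -- An element of order 1 is zero and has cross number 1, so alone it is a tiny zero-sum
    -- subsequence. Its coordinate sum and `1 ℕ.* toℕ (g i)` both reduce to `toℕ (g i) ℕ.+ 0`.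
    go (g ∷ L) τ (o ∷ _) = contradiction
      (g ∷ [] , ⊆-trans (refl ∷ minimum L) τ , (λ ()) ,
        subst (λ k → Kills k g) o (ord-kills g) ,
        ℚₚ.≤-reflexive (trans (ℚₚ.+-identityʳ _) (recip-cong o)))
      ¬tiny

  -- Prepending `g` adds 1/ord(g) to the class of its order, which is among those summed because the
  -- order is at most `e`.
  crossNumber≤∑ofOrder : ∀ e → (∀ g → ord g ℕ.≤ e) → ∀ S →
    crossNumber S ≤ ∑ (λ j → crossNumber (ofOrder (suc j) S)) (upTo e)
  crossNumber≤∑ofOrder e ord≤e [] = ℚₚ.≤-reflexive (sym (∑-0 (upTo e)))
  crossNumber≤∑ofOrder e ord≤e (g ∷ S) = ℚₚ.≤-trans
    (ℚₚ.+-monoʳ-≤ (+ 1 / ord g) (crossNumber≤∑ofOrder e ord≤e S))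
    (∑-bump {ε = + 1 / ord g} (λ j → mono j (ord g ℕ.≟ suc j))
      -- `ord g` is a successor by definition, so `ord≤e g` also says that its index, the
      -- predecessor, is below `e`.
      (ℚₚ.≤-reflexive (sym (accept (ord g) refl))) (∈-upTo⁺ (ord≤e g)))
    where
    accept : ∀ d → ord g ≡ d →
      crossNumber (ofOrder d (g ∷ S)) ≡ (+ 1 / ord g) + crossNumber (ofOrder d S)
    accept d o = cong crossNumber (Listₚ.filter-accept (λ g → ord g ℕ.≟ d) {g} {S} o)

    mono : ∀ j → Dec (ord g ≡ suc j) →
      crossNumber (ofOrder (suc j) S) ≤ crossNumber (ofOrder (suc j) (g ∷ S))
    mono j (yes o) = begin
      k                ≡⟨ ℚₚ.+-identityˡ k ⟨
      0ℚ + k           ≤⟨ ℚₚ.+-monoˡ-≤ k (/-mono 0 0 1 (ℕ.pred (ord g)) z≤n) ⟩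
      + 1 / ord g + k  ≡⟨ accept (suc j) o ⟨
      crossNumber (ofOrder (suc j) (g ∷ S)) ∎
      where
      open ℚₚ.≤-Reasoning
      k = crossNumber (ofOrder (suc j) S)
    mono j (no ¬o) = ℚₚ.≤-reflexive
      (cong crossNumber (sym (Listₚ.filter-reject (λ g → ord g ℕ.≟ suc j) {g} {S} ¬o)))

  -- Compressing keeps k(S) from decreasing and shortens S, so it suffices to bound k(S)
  -- for sequences that cannot be compressed.
  crossNumber≤-incompressible : ∀ e (p t : ℕ → ℕ) →
    (∀ j → 1 < p j × p j ∣ suc (suc j) × EtaProp r (p j) (t j)) → (b : ℚ) →
    (∀ S → ¬ HasTinyZeroSum S →
      (∀ {j} → j < e → length (ofOrder (suc (suc j)) S) < t j) → crossNumber S ≤ b) →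
    ∀ S → ¬ HasTinyZeroSum S → crossNumber S ≤ b
  crossNumber≤-incompressible e p t η b bounded S₀ = go (length S₀) S₀ ℕₚ.≤-refl
    where
    -- Index `j` stands for order `suc (suc j)`: order 1 has no prime divisor and is left to a
    -- separate argument.
    Compressible : List G → Set
    Compressible S = ∃ λ j → j < e × t j ℕ.≤ length (ofOrder (suc (suc j)) S)

    compressible? : ∀ S → Dec (Compressible S)
    compressible? S = ℕₚ.anyUpTo? (λ j → t j ℕ.≤? length (ofOrder (suc (suc j)) S)) e

    Shorter : List G → Set
    Shorter S = ∃ λ S′ → length S′ < length S × crossNumber S ≤ crossNumber S′ × ¬ HasTinyZeroSum S′

    shorten : ∀ S → ¬ HasTinyZeroSum S → Compressible S → Shorter S
    shorten S ¬tiny (j , _ , t≤) =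
      let 1<p , p∣ , ηⱼ = η j in compress (suc j) 1<p p∣ ηⱼ S t≤ ¬tiny

    -- `N` bounds the length and drops with each compression, which makes the recursion structural.
    go : ∀ N S → length S ℕ.≤ N → ¬ HasTinyZeroSum S → crossNumber S ≤ b

    next : ∀ N S → length S ℕ.≤ N → Shorter S → crossNumber S ≤ b
    next zero S |S|≤N (_ , shorter , _) = contradiction (ℕₚ.<-≤-trans shorter |S|≤N) λ ()
    next (suc N) S |S|≤N (S′ , shorter , k≤ , ¬tiny) =
      ℚₚ.≤-trans k≤ (go N S′ (ℕ.s≤s⁻¹ (ℕₚ.<-≤-trans shorter |S|≤N)) ¬tiny)

    split : ∀ N S → length S ℕ.≤ N → ¬ HasTinyZeroSum S → Dec (Compressible S) → crossNumber S ≤ b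
    split N S |S|≤N ¬tiny (yes comp) = next N S |S|≤N (shorten S ¬tiny comp)
    split N S |S|≤N ¬tiny (no incomp) =
      bounded S ¬tiny λ j<e → ℕₚ.≰⇒> λ t≤ → incomp (_ , j<e , t≤)

    go N S |S|≤N ¬tiny = split N S |S|≤N ¬tiny (compressible? S)

-- The divisor sum and the final estimate

-- The summand of divSum is local to its definition; unification recovers it from the fold.
divSum-foldr : ∀ e → ∃ λ f → divSum e ≡ foldr f 0ℚ (upTo e)
divSum-foldr e = _ , refl

-- A top-level copy of the summand, on which divisibility cases can be decided from outside.
divTerm : ℕ → ℕ → ℚ
divTerm e j with suc j ∣? e
... | yes _ = + (minPrimeDiv (suc j) ∸ 1) / suc j
... | no _ = 0ℚ

divSum≡∑ : ∀ e → divSum e ≡ ∑ (divTerm e) (upTo e)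
divSum≡∑ e = Listₚ.foldr-cong summand refl (upTo e)
  where
  summand : ∀ j acc → proj₁ (divSum-foldr e) j acc ≡ divTerm e j + acc
  summand j acc with suc j ∣? e
  ... | yes _ = refl
  ... | no _ = refl

divTerm-∣ : ∀ e j → suc j ∣ e → divTerm e j ≡ + (minPrimeDiv (suc j) ∸ 1) / suc j
divTerm-∣ e j d∣e with suc j ∣? e
... | yes _ = refl
... | no d∤e = contradiction d∣e d∤e

divTerm-∤ : ∀ e j → ¬ suc j ∣ e → divTerm e j ≡ 0ℚ
divTerm-∤ e j d∤e with suc j ∣? e
... | yes d∣e = contradiction d∣e d∤e
... | no _ = refl

theorem9 : (k : ℕ) (n : Fin (suc k) → ℕ) →
    ((i : Fin (suc k)) → 1 < n i) →
    ((i j : Fin (suc k)) → i ≤ᶠ j → n i ∣ n j) →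
    (c : ℚ) → AlonDubinerConst (suc k) c →
    (S : List (Elem (suc k) n)) → ¬ HasTinyZeroSum S →
    crossNumber S ≤ c * divSum (n (fromℕ k))
theorem9 k n 1<n n∣n c (0<c , η≤) =
  crossNumber≤-incompressible e (λ j → minPrimeDiv (suc (suc j))) t
    (λ j → 1<P⁻ j , proj₂ (spec j) , proj₁ (proj₂ (η-bound j))) (c * divSum e) bounded
  where
  e = n (fromℕ k)

  instance
    n-nonZero : ∀ {i} → NonZero (n i)
    n-nonZero {i} = ℕ.>-nonZero (ℕₚ.<-trans (s≤s z≤n) (1<n i))

    c-nonNeg : ℚ.NonNegative c
    c-nonNeg = ℚ.nonNegative (ℚₚ.<⇒≤ 0<c)

  -- Every `n i` divides the last one, so `e` kills the whole group.
  ord∣e : (g : Elem (suc k) n) → ord g ∣ e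
  ord∣e g = ord-∣ g e (λ i → ∣-trans (n∣n i (fromℕ k) (Finₚ.≤fromℕ i)) (m∣m*n (toℕ (g i))))

  module _ (j : ℕ) where
    spec = minPrimeDiv-spec (suc (suc j)) (s≤s (s≤s z≤n))

    1<P⁻ : 1 < minPrimeDiv (suc (suc j))
    1<P⁻ = ℕ.nonTrivial⇒n>1 _ {{prime⇒nonTrivial (proj₁ spec)}}

    η-bound = η≤ (minPrimeDiv (suc (suc j))) (ℕₚ.<⇒≤ 1<P⁻)

  t : ℕ → ℕ
  t j = proj₁ (η-bound j)

  bounded : (S : List (Elem (suc k) n)) → ¬ HasTinyZeroSum S →
    (∀ {j} → j < e → length (ofOrder (suc (suc j)) S) < t j) →
    crossNumber S ≤ c * divSum e
  bounded S ¬tiny few = begin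
    crossNumber S
      ≤⟨ crossNumber≤∑ofOrder e (λ g → ∣⇒≤ (ord∣e g)) S ⟩
    ∑ (λ j → crossNumber (ofOrder (suc j) S)) (upTo e)
      ≤⟨ ∑-mono (λ j → byOrder j (suc j ∣? e)) (upTo e) ⟩
    ∑ (λ j → c * divTerm e j) (upTo e)
      ≡⟨ ∑-*ˡ c (divTerm e) (upTo e) ⟩
    c * ∑ (divTerm e) (upTo e)
      ≡⟨ cong (c *_) (divSum≡∑ e) ⟨
    c * divSum e ∎
    where
    open ℚₚ.≤-Reasoning

    length-ofOrder : ∀ j → suc j ∣ e →
      toℚ (length (ofOrder (suc j) S)) ≤ c * toℚ (minPrimeDiv (suc j) ∸ 1)
    -- For d = 1 both sides vanish: no element has order 1, and the default P⁻(1) = 1 makes the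
    -- right side 0.
    length-ofOrder zero _ = ℚₚ.≤-reflexive
      (trans (cong (toℚ ∘ length) (ofOrder-1≡[] S ¬tiny)) (sym (ℚₚ.*-zeroʳ c)))
    length-ofOrder (suc j) d∣e = +-cancelˡ-≤ 1ℚ (begin
      1ℚ + toℚ (length (ofOrder (suc (suc j)) S))
        ≡⟨ toℚ-suc (length (ofOrder (suc (suc j)) S)) ⟨
      toℚ (suc (length (ofOrder (suc (suc j)) S)))
        -- Since `few` is strict, the length plus one is at most `t j`. This extra 1 cancels the one
        -- in c(P⁻(d) - 1) + 1.
        ≤⟨ toℚ-mono (few (ℕₚ.<⇒≤ (∣⇒≤ d∣e))) ⟩
      toℚ (t j)
        ≤⟨ proj₂ (proj₂ (η-bound j)) ⟩
      c * toℚ (minPrimeDiv (suc (suc j)) ∸ 1) + 1ℚ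
        ≡⟨ ℚₚ.+-comm (c * toℚ (minPrimeDiv (suc (suc j)) ∸ 1)) 1ℚ ⟩
      1ℚ + c * toℚ (minPrimeDiv (suc (suc j)) ∸ 1) ∎)

    byOrder : ∀ j → Dec (suc j ∣ e) → crossNumber (ofOrder (suc j) S) ≤ c * divTerm e j
    -- Orders divide `e`, so this class is empty, and the summand is 0.
    byOrder j (no d∤e) = ℚₚ.≤-reflexive
      (trans (cong crossNumber (Listₚ.filter-none (λ g → ord g ℕ.≟ suc j)
               {xs = S} none))
        (sym (trans (cong (c *_) (divTerm-∤ e j d∤e)) (ℚₚ.*-zeroʳ c))))
      where
      none : All (λ g → ¬ (ord g ≡ suc j)) S
      none = All.universal (λ (g : Elem (suc k) n) (o : ord g ≡ suc j) → d∤e (subst (_∣ e) o (ord∣e g))) S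
    byOrder j (yes d∣e) = begin
      crossNumber (ofOrder (suc j) S)
        ≡⟨ crossNumber-const j _ (all-filter (λ g → ord g ℕ.≟ suc j) S) ⟩
      + length (ofOrder (suc j) S) / suc j
        ≡⟨ toℚ-*-recip (length (ofOrder (suc j) S)) j ⟨
      toℚ (length (ofOrder (suc j) S)) * (+ 1 / suc j)
        ≤⟨ ℚₚ.*-monoʳ-≤-nonNeg (+ 1 / suc j) {{ℚₚ.normalize-nonNeg 1 (suc j)}} (length-ofOrder j d∣e) ⟩
      c * toℚ P⁻-1 * (+ 1 / suc j)
        ≡⟨ ℚₚ.*-assoc c (toℚ P⁻-1) (+ 1 / suc j) ⟩
      c * (toℚ P⁻-1 * (+ 1 / suc j))
        ≡⟨ cong (c *_) (toℚ-*-recip P⁻-1 j) ⟩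
      c * (+ P⁻-1 / suc j)
        ≡⟨ cong (c *_) (divTerm-∣ e j d∣e) ⟨
      c * divTerm e j ∎
      where P⁻-1 = minPrimeDiv (suc j) ∸ 1
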